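{- Let $\mathscr{M}$ be a finite rooted transition system in which every state is reachable from the initial state (connected, reachable). Let $\mathrm{Lind}$ be the Lindenbaum algebra of the propositional geometric theory $\mathbb{T}$ whose atoms are $\Delta(s,t)$ for states $s,t$ and whose axioms are $\Delta(s,t)\vdash\bot$ whenever $s\not\to t$, and $\top\vdash\bigvee_{t:\,s\to t}\Delta(s,t)$ for every state $s$ having at least one successor. Let $\mathrm{Aut}(\mathrm{graph})$ be the group of permutations $\sigma$ of the states with $s\to t\iff\sigma(s)\to\sigma(t)$, and let $\varphi:\mathrm{Aut}(\mathrm{graph})\to\mathrm{Aut}(\mathrm{Lind})$ be the group homomorphism induced by the atom permutation $\Delta(s,t)\mapsto\Delta(\sigma(s),\sigma(t))$. Then either $\ker\varphi$ is trivial or $\ker\varphi=\mathrm{Aut}(\mathrm{graph})$. Specifically, $\ker\varphi$ is trivial whenever some state has at least two successors, and $\ker\varphi=\mathrm{Aut}(\mathrm{graph})$ when every state has at most one successor.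
   Context: The Lindenbaum algebra of a propositional geometric theory is the frame presented by the atoms as generators, modulo the relations induced by the axioms (the quotient of the free frame on the atoms). -}

module Defs where

open import Algebra.Bundles using (Group)
open import Algebra.Bundles.Raw using (RawGroup)
open import Algebra.Morphism.Bundles using (GroupHomomorphism)
open import Data.Empty using (⊥)
open import Data.Fin using (Fin)
open import Data.Nat using (ℕ)
open import Data.Product using (∃-syntax; _×_; _,_; proj₁)
open import Function using (_∘_)
open import Function.Bundles using (_↔_; _⇔_; Inverse; Equivalence; mk⇔)
open import Function.Construct.Composition using (_↔-∘_; _⇔-∘_)
open import Function.Construct.Identity using (↔-id; ⇔-id)
open import Function.Construct.Symmetry using (↔-sym)
open import Level using (Level; _⊔_; 0ℓ) renaming (suc to lsuc)
open import Relation.Binary using (Rel; Decidable; Setoid)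
open import Relation.Binary.Construct.Closure.ReflexiveTransitive using (Star)
open import Relation.Binary.Lattice using (IsBoundedMeetSemilattice)
open import Relation.Binary.PropositionalEquality
  using (_≡_; _≢_; refl; sym; trans; cong; subst; subst₂)
open import Relation.Nullary using (¬_)
open import Relation.Unary using (Pred)

private
  variable
    a c c′ ℓ ℓ′ ℓ₁ ℓ₁′ ℓ₂ ℓ₂′ : Level

------------------------------------------------------------------------
-- Frames

-- Predicatively, "arbitrary" joins are joins of families indexed by types
-- in Set.
record Frame c ℓ₁ ℓ₂ : Set (lsuc (c ⊔ ℓ₁ ⊔ ℓ₂)) where
  infix  4 _≈_ _≤_
  infixr 7 _∧_
  field
    Carrier  : Set c
    _≈_      : Rel Carrier ℓ₁
    _≤_      : Rel Carrier ℓ₂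
    _∧_      : Carrier → Carrier → Carrier
    ⊤        : Carrier
    ⋁        : (I : Set) → (I → Carrier) → Carrier
    isBoundedMeetSemilattice : IsBoundedMeetSemilattice _≈_ _≤_ _∧_ ⊤
    ⋁-upper  : ∀ {I} (f : I → Carrier) i → f i ≤ ⋁ I f
    ⋁-least  : ∀ {I} (f : I → Carrier) {x} → (∀ i → f i ≤ x) → ⋁ I f ≤ x
    ∧-distrib-⋁ : ∀ x {I} (f : I → Carrier) → x ∧ ⋁ I f ≤ ⋁ I (λ i → x ∧ f i)

  open IsBoundedMeetSemilattice isBoundedMeetSemilattice public
    renaming (refl to ≤-refl; trans to ≤-trans; reflexive to ≤-reflexive)

  setoid : Setoid c ℓ₁
  setoid = record { isEquivalence = isEquivalence }

  module ≈ = Setoid setoid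

  ∧-cong : ∀ {x x′ y y′} → x ≈ x′ → y ≈ y′ → x ∧ y ≈ x′ ∧ y′
  ∧-cong p q = antisym
    (∧-greatest (≤-trans (x∧y≤x _ _) (≤-reflexive p))
                (≤-trans (x∧y≤y _ _) (≤-reflexive q)))
    (∧-greatest (≤-trans (x∧y≤x _ _) (≤-reflexive (≈.sym p)))
                (≤-trans (x∧y≤y _ _) (≤-reflexive (≈.sym q))))

  ⋁-cong : ∀ {I} {f g : I → Carrier} → (∀ i → f i ≈ g i) → ⋁ I f ≈ ⋁ I g
  ⋁-cong p = antisym
    (⋁-least _ λ i → ≤-trans (≤-reflexive (p i)) (⋁-upper _ i))
    (⋁-least _ λ i → ≤-trans (≤-reflexive (≈.sym (p i))) (⋁-upper _ i))

record FrameHom (F : Frame c ℓ₁ ℓ₂) (G : Frame c′ ℓ₁′ ℓ₂′)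
  : Set (lsuc 0ℓ ⊔ c ⊔ ℓ₁ ⊔ c′ ⊔ ℓ₁′) where
  private
    module F = Frame F
    module G = Frame G
  field
    ⟦_⟧    : F.Carrier → G.Carrier
    ⟦⟧-cong : ∀ {x y} → x F.≈ y → ⟦ x ⟧ G.≈ ⟦ y ⟧
    ⊤-homo : ⟦ F.⊤ ⟧ G.≈ G.⊤
    ∧-homo : ∀ x y → ⟦ x F.∧ y ⟧ G.≈ ⟦ x ⟧ G.∧ ⟦ y ⟧
    ⋁-homo : ∀ {I} (f : I → F.Carrier) → ⟦ F.⋁ I f ⟧ G.≈ G.⋁ I (⟦_⟧ ∘ f)

open FrameHom using (⟦_⟧)

idHom : (F : Frame c ℓ₁ ℓ₂) → FrameHom F F
idHom F = record
  { ⟦_⟧    = λ x → x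
  ; ⟦⟧-cong = λ p → p
  ; ⊤-homo = ≈.refl
  ; ∧-homo = λ _ _ → ≈.refl
  ; ⋁-homo = λ _ → ≈.refl
  } where open Frame F

infixr 9 _∘ʰ_

_∘ʰ_ : {F G H : Frame c ℓ₁ ℓ₂} → FrameHom G H → FrameHom F G → FrameHom F H
_∘ʰ_ {H = H} g f = record
  { ⟦_⟧    = λ x → ⟦ g ⟧ (⟦ f ⟧ x)
  ; ⟦⟧-cong = λ p → g.⟦⟧-cong (f.⟦⟧-cong p)
  ; ⊤-homo = ≈.trans (g.⟦⟧-cong f.⊤-homo) g.⊤-homo
  ; ∧-homo = λ x y → ≈.trans (g.⟦⟧-cong (f.∧-homo x y)) (g.∧-homo _ _)
  ; ⋁-homo = λ h → ≈.trans (g.⟦⟧-cong (f.⋁-homo h)) (g.⋁-homo _)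
  } where
  open Frame H
  module f = FrameHom f
  module g = FrameHom g

record FrameAut (F : Frame c ℓ₁ ℓ₂) : Set (lsuc 0ℓ ⊔ c ⊔ ℓ₁) where
  open Frame F
  field
    to       : FrameHom F F
    from     : FrameHom F F
    to∘from  : ∀ x → ⟦ to ⟧ (⟦ from ⟧ x) ≈ x
    from∘to  : ∀ x → ⟦ from ⟧ (⟦ to ⟧ x) ≈ x

-- Automorphisms are compared pointwise; multiplication is composition.
Aut : Frame c ℓ₁ ℓ₂ → Group (lsuc 0ℓ ⊔ c ⊔ ℓ₁) (c ⊔ ℓ₁)
Aut F = record
  { Carrier = FrameAut F
  ; _≈_     = λ α β → ∀ x → ⟦ to α ⟧ x ≈ ⟦ to β ⟧ x
  ; _∙_     = λ α β → record
      { to      = to α ∘ʰ to β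
      ; from    = from β ∘ʰ from α
      ; to∘from = λ x → ≈.trans (⟦⟧-cong (to α) (to∘from β _)) (to∘from α x)
      ; from∘to = λ x → ≈.trans (⟦⟧-cong (from β) (from∘to α _)) (from∘to β x)
      }
  ; ε       = record
      { to      = idHom F
      ; from    = idHom F
      ; to∘from = λ _ → ≈.refl
      ; from∘to = λ _ → ≈.refl
      }
  ; _⁻¹     = λ α → record
      { to      = from α
      ; from    = to α
      ; to∘from = from∘to α
      ; from∘to = to∘from α
      }
  ; isGroup = record
      { isMonoid = record
          { isSemigroup = record
              { isMagma = record
                  { isEquivalence = record
                      { refl  = λ _ → ≈.refl
                      ; sym   = λ p x → ≈.sym (p x)
                      ; trans = λ p q x → ≈.trans (p x) (q x)
                      }
                  ; ∙-cong = λ {α} {α′} {β} {β′} p q x →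
                      ≈.trans (p _) (⟦⟧-cong (to α′) (q x))
                  }
              ; assoc = λ _ _ _ _ → ≈.refl
              }
          ; identity = (λ _ _ → ≈.refl) , (λ _ _ → ≈.refl)
          }
      ; inverse = from∘to , to∘from
      ; ⁻¹-cong = λ {α} {β} p x →
          ≈.trans
            (≈.sym (⟦⟧-cong (from α) (to∘from β x)))
            (≈.trans (≈.sym (⟦⟧-cong (from α) (p _))) (from∘to α _))
      }
  } where
  open Frame F
  open FrameHom using (⟦⟧-cong)
  open FrameAut

------------------------------------------------------------------------
-- Propositional geometric theories and their Lindenbaum algebras

data Formula (Atom : Set) : Set₁ where
  atom : Atom → Formula Atom
  ⊤ᶠ   : Formula Atom
  _∧ᶠ_ : Formula Atom → Formula Atom → Formula Atom
  ⋁ᶠ   : (I : Set) → (I → Formula Atom) → Formula Atom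

⊥ᶠ : ∀ {Atom} → Formula Atom
⊥ᶠ = ⋁ᶠ ⊥ λ ()

record Theory : Set₂ where
  field
    Atom  : Set
    Axiom : Rel (Formula Atom) (lsuc 0ℓ)

module _ (T : Theory) where
  open Theory T

  infix 4 _⊢_

  data _⊢_ : Rel (Formula Atom) (lsuc 0ℓ) where
    axiom   : ∀ {A B} → Axiom A B → A ⊢ B
    ⊢-refl  : ∀ {A} → A ⊢ A
    ⊢-trans : ∀ {A B C} → A ⊢ B → B ⊢ C → A ⊢ C
    ⊤-intro : ∀ {A} → A ⊢ ⊤ᶠ
    ∧-elimˡ : ∀ {A B} → A ∧ᶠ B ⊢ A
    ∧-elimʳ : ∀ {A B} → A ∧ᶠ B ⊢ B
    ∧-intro : ∀ {A B C} → C ⊢ A → C ⊢ B → C ⊢ A ∧ᶠ B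
    ⋁-intro : ∀ {I} {f : I → Formula Atom} i → f i ⊢ ⋁ᶠ I f
    ⋁-elim  : ∀ {I} {f : I → Formula Atom} {C} → (∀ i → f i ⊢ C) → ⋁ᶠ I f ⊢ C
    distrib : ∀ {A I} {f : I → Formula Atom} →
              A ∧ᶠ ⋁ᶠ I f ⊢ ⋁ᶠ I (λ i → A ∧ᶠ f i)

  -- Formulas modulo interderivability.  With no axioms this is the free
  -- frame on the atoms; in general it is its quotient by the axioms (see
  -- `extend` and `hom-unique` for the universal property).
  Lindenbaum : Frame (lsuc 0ℓ) (lsuc 0ℓ) (lsuc 0ℓ)
  Lindenbaum = record
    { Carrier  = Formula Atom
    ; _≈_      = λ A B → (A ⊢ B) × (B ⊢ A)
    ; _≤_      = _⊢_
    ; _∧_      = _∧ᶠ_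
    ; ⊤        = ⊤ᶠ
    ; ⋁        = ⋁ᶠ
    ; isBoundedMeetSemilattice = record
        { isMeetSemilattice = record
            { isPartialOrder = record
                { isPreorder = record
                    { isEquivalence = record
                        { refl  = ⊢-refl , ⊢-refl
                        ; sym   = λ (p , q) → q , p
                        ; trans = λ (p , q) (p′ , q′) →
                            ⊢-trans p p′ , ⊢-trans q′ q
                        }
                    ; reflexive = proj₁
                    ; trans     = ⊢-trans
                    }
                ; antisym = _,_
                }
            ; infimum = λ _ _ → ∧-elimˡ , ∧-elimʳ , λ _ → ∧-intro
            }
        ; maximum = λ _ → ⊤-intro
        }
    ; ⋁-upper  = λ _ → ⋁-intro
    ; ⋁-least  = λ _ → ⋁-elim
    ; ∧-distrib-⋁ = λ _ _ → distrib
    }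

module _ {T : Theory} (F : Frame c ℓ₁ ℓ₂) where
  open Theory T
  open Frame F

  interpret : (Atom → Carrier) → Formula Atom → Carrier
  interpret v (atom x)  = v x
  interpret v ⊤ᶠ        = ⊤
  interpret v (A ∧ᶠ B)  = interpret v A ∧ interpret v B
  interpret v (⋁ᶠ I f)  = ⋁ I (λ i → interpret v (f i))

  module _ (v : Atom → Carrier)
           (v-axiom : ∀ {A B} → Axiom A B → interpret v A ≤ interpret v B)
    where

    sound : ∀ {A B} → _⊢_ T A B → interpret v A ≤ interpret v B
    sound (axiom p)     = v-axiom p
    sound ⊢-refl        = ≤-refl
    sound (⊢-trans p q) = ≤-trans (sound p) (sound q)
    sound ⊤-intro       = maximum _
    sound ∧-elimˡ       = x∧y≤x _ _
    sound ∧-elimʳ       = x∧y≤y _ _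
    sound (∧-intro p q) = ∧-greatest (sound p) (sound q)
    sound (⋁-intro i)   = ⋁-upper _ i
    sound (⋁-elim p)    = ⋁-least _ λ i → sound (p i)
    sound distrib       = ∧-distrib-⋁ _ _

    extend : FrameHom (Lindenbaum T) F
    extend = record
      { ⟦_⟧    = interpret v
      ; ⟦⟧-cong = λ (p , q) → antisym (sound p) (sound q)
      ; ⊤-homo = ≈.refl
      ; ∧-homo = λ _ _ → ≈.refl
      ; ⋁-homo = λ _ → ≈.refl
      }

  hom-unique : (g h : FrameHom (Lindenbaum T) F) →
               (∀ x → ⟦ g ⟧ (atom x) ≈ ⟦ h ⟧ (atom x)) →
               ∀ A → ⟦ g ⟧ A ≈ ⟦ h ⟧ A
  hom-unique g h p = go
    where
    module g = FrameHom g
    module h = FrameHom h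
    go : ∀ A → ⟦ g ⟧ A ≈ ⟦ h ⟧ A
    go (atom x)  = p x
    go ⊤ᶠ        = ≈.trans g.⊤-homo (≈.sym h.⊤-homo)
    go (A ∧ᶠ B)  = ≈.trans (g.∧-homo A B)
                     (≈.trans (∧-cong (go A) (go B)) (≈.sym (h.∧-homo A B)))
    go (⋁ᶠ I f)  = ≈.trans (g.⋁-homo f)
                     (≈.trans (⋁-cong (λ i → go (f i))) (≈.sym (h.⋁-homo f)))

------------------------------------------------------------------------
-- Finite rooted transition systems

-- Decidability of the transition relation is part of finiteness: it makes
-- the set of transitions, and not only the set of states, finite.
record TransitionSystem : Set₁ where
  infix 4 _⟶_ _⟶?_
  field
    State  : Set
    size   : ℕ
    finite : State ↔ Fin size
    _⟶_    : Rel State 0ℓ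
    _⟶?_   : Decidable _⟶_
    init   : State

  AllReachable : Set
  AllReachable = ∀ s → Star _⟶_ init s

  HasSuccessor : State → Set
  HasSuccessor s = ∃[ t ] s ⟶ t

  AtLeastTwoSuccessors : State → Set
  AtLeastTwoSuccessors s = ∃[ t ] ∃[ t′ ] (t ≢ t′ × s ⟶ t × s ⟶ t′)

  AtMostOneSuccessor : State → Set
  AtMostOneSuccessor s = ∀ {t t′} → s ⟶ t → s ⟶ t′ → t ≡ t′

module _ (M : TransitionSystem) where
  open TransitionSystem M

  -- Automorphisms of the graph; they need not fix the initial state.
  record GraphAut : Set where
    field
      perm      : State ↔ State
    open Inverse perm public using (to; from; strictlyInverseˡ; strictlyInverseʳ)
    field
      preserves : ∀ s t → s ⟶ t ⇔ to s ⟶ to t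

  open GraphAut

  _∙ᵍ_ : GraphAut → GraphAut → GraphAut
  σ ∙ᵍ τ = record
    { perm      = perm σ ↔-∘ perm τ
    ; preserves = λ s t → preserves σ _ _ ⇔-∘ preserves τ s t
    }

  εᵍ : GraphAut
  εᵍ = record { perm = ↔-id State ; preserves = λ _ _ → ⇔-id _ }

  _⁻¹ᵍ : GraphAut → GraphAut
  σ ⁻¹ᵍ = record
    { perm      = ↔-sym (perm σ)
    ; preserves = λ s t → mk⇔
        (λ p → Equivalence.from (preserves σ _ _)
          (subst₂ _⟶_ (sym (strictlyInverseˡ σ s)) (sym (strictlyInverseˡ σ t)) p))
        (λ p → subst₂ _⟶_ (strictlyInverseˡ σ s) (strictlyInverseˡ σ t)
          (Equivalence.to (preserves σ _ _) p))
    }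

  AutGraph : Group 0ℓ 0ℓ
  AutGraph = record
    { Carrier = GraphAut
    ; _≈_     = λ σ τ → ∀ s → to σ s ≡ to τ s
    ; _∙_     = _∙ᵍ_
    ; ε       = εᵍ
    ; _⁻¹     = _⁻¹ᵍ
    ; isGroup = record
        { isMonoid = record
            { isSemigroup = record
                { isMagma = record
                    { isEquivalence = record
                        { refl  = λ _ → refl
                        ; sym   = λ p s → sym (p s)
                        ; trans = λ p q s → trans (p s) (q s)
                        }
                    ; ∙-cong = λ {σ} {σ′} {τ} {τ′} p q s →
                        trans (p _) (cong (to σ′) (q s))
                    }
                ; assoc = λ _ _ _ _ → refl
                }
            ; identity = (λ _ _ → refl) , (λ _ _ → refl)
            }
        ; inverse = strictlyInverseʳ , strictlyInverseˡ
        ; ⁻¹-cong = λ {σ} {τ} p s →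
            trans
              (sym (cong (from σ) (strictlyInverseˡ τ s)))
              (trans (sym (cong (from σ) (p _))) (strictlyInverseʳ σ _))
        }
    }

  data TransitionAtom : Set where
    Δ : State → State → TransitionAtom

  data TransitionAxiom : Rel (Formula TransitionAtom) (lsuc 0ℓ) where
    no-transition : ∀ {s t} → ¬ (s ⟶ t) → TransitionAxiom (atom (Δ s t)) ⊥ᶠ
    progress      : ∀ {s} → HasSuccessor s →
                    TransitionAxiom ⊤ᶠ (⋁ᶠ (∃[ t ] s ⟶ t) λ (t , _) → atom (Δ s t))

  𝕋 : Theory
  𝕋 = record { Atom = TransitionAtom ; Axiom = TransitionAxiom }

  Lind : Frame (lsuc 0ℓ) (lsuc 0ℓ) (lsuc 0ℓ)
  Lind = Lindenbaum 𝕋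

  permuteAtom : GraphAut → TransitionAtom → TransitionAtom
  permuteAtom σ (Δ s t) = Δ (to σ s) (to σ t)

  private
    module L = Frame Lind

    permuteAtom-axiom : ∀ σ {A B} → TransitionAxiom A B →
      interpret {T = 𝕋} Lind (atom ∘ permuteAtom σ) A L.≤
      interpret {T = 𝕋} Lind (atom ∘ permuteAtom σ) B
    permuteAtom-axiom σ (no-transition ¬p) =
      ⊢-trans (axiom (no-transition (¬p ∘ Equivalence.from (preserves σ _ _))))
              (⋁-elim λ ())
    permuteAtom-axiom σ (progress {s} (t , p)) =
      ⊢-trans (axiom (progress (to σ t , Equivalence.to (preserves σ _ _) p)))
              (⋁-elim λ (u , q) →
                subst (λ w → _⊢_ 𝕋 (atom (Δ (to σ s) w)) _) (strictlyInverseˡ σ u)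
                  (⋁-intro (from σ u , Equivalence.from (preserves σ _ _)
                    (subst (to σ s ⟶_) (sym (strictlyInverseˡ σ u)) q))))

  inducedHom : GraphAut → FrameHom Lind Lind
  inducedHom σ = extend Lind (atom ∘ permuteAtom σ) (permuteAtom-axiom σ)

  private
    atom-cong : ∀ {s s′ t t′} → s ≡ s′ → t ≡ t′ →
                atom (Δ s t) L.≈ atom (Δ s′ t′)
    atom-cong refl refl = L.≈.refl

    induced-cong : ∀ σ τ → (∀ s → to σ s ≡ to τ s) →
                   ∀ A → ⟦ inducedHom σ ⟧ A L.≈ ⟦ inducedHom τ ⟧ A
    induced-cong σ τ p = hom-unique Lind (inducedHom σ) (inducedHom τ)
      λ { (Δ s t) → atom-cong (p s) (p t) }

    induced-∙ : ∀ σ τ A → ⟦ inducedHom (σ ∙ᵍ τ) ⟧ A L.≈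
                          ⟦ inducedHom σ ⟧ (⟦ inducedHom τ ⟧ A)
    induced-∙ σ τ = hom-unique Lind (inducedHom (σ ∙ᵍ τ)) (inducedHom σ ∘ʰ inducedHom τ)
      λ { (Δ s t) → L.≈.refl }

    induced-ε : ∀ A → ⟦ inducedHom εᵍ ⟧ A L.≈ A
    induced-ε = hom-unique Lind (inducedHom εᵍ) (idHom Lind) λ { (Δ s t) → L.≈.refl }

  inducedAut : GraphAut → FrameAut Lind
  inducedAut σ = record
    { to      = inducedHom σ
    ; from    = inducedHom (σ ⁻¹ᵍ)
    ; to∘from = λ A → L.≈.trans (L.≈.sym (induced-∙ σ (σ ⁻¹ᵍ) A))
        (L.≈.trans (induced-cong (σ ∙ᵍ (σ ⁻¹ᵍ)) εᵍ (strictlyInverseˡ σ) A) (induced-ε A))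
    ; from∘to = λ A → L.≈.trans (L.≈.sym (induced-∙ (σ ⁻¹ᵍ) σ A))
        (L.≈.trans (induced-cong ((σ ⁻¹ᵍ) ∙ᵍ σ) εᵍ (strictlyInverseʳ σ) A) (induced-ε A))
    }

  φ : GroupHomomorphism (Group.rawGroup AutGraph) (Group.rawGroup (Aut Lind))
  φ = record
    { ⟦_⟧ = inducedAut
    ; isGroupHomomorphism = record
        { isMonoidHomomorphism = record
            { isMagmaHomomorphism = record
                { isRelHomomorphism = record
                    { cong = λ {σ} {τ} → induced-cong σ τ }
                ; homo = induced-∙
                }
            ; ε-homo = induced-ε
            }
        ; ⁻¹-homo = λ _ _ → L.≈.refl
        }
    }

------------------------------------------------------------------------
-- Kernels

module _ {G : RawGroup c ℓ} {H : RawGroup c′ ℓ′} where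
  private
    module G = RawGroup G
    module H = RawGroup H

  ker : GroupHomomorphism G H → Pred G.Carrier ℓ′
  ker f x = GroupHomomorphism.⟦_⟧ f x H.≈ H.ε

-- Subgroups are predicates on a setoid, so the trivial one is the
-- ≈-class of ε.
trivialSubgroup : (G : Group c ℓ) → Pred (Group.Carrier G) ℓ
trivialSubgroup G x = x ≈ ε where open Group G

{-# OPTIONS --safe #-}

-- A point of Lind is a set of transitions meeting the transitions out of
-- every state that has a successor.  If s′ has a successor other than t′,
-- then all transitions but s′ ⟶ t′ form such a point, so Δ s′ t′ lies above
-- no other transition.  Hence an element σ of the kernel fixes every
-- branching state and its successors, and therefore everything reachable
-- from a branching state, since a fixed state with a unique successor has a
-- fixed successor.  Before the first branching state, the path from the
-- initial state is forced; as σ preserves the number of steps to the first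
-- branching, σ init is init or is reachable from a branching state, and
-- either way σ fixes init.  Without branching, every atom is ⊤ or ⊥.
module Submission where

open import Defs
open import Algebra.Morphism.Bundles using (module GroupHomomorphism)
open import Data.Empty using (⊥-elim)
open import Data.Fin.Properties using (any?; inj⇒≟)
open import Data.Nat using (ℕ; zero; suc; _<_)
open import Data.Nat.Properties using (n<1+n; m<n⇒m<1+n; <-irrefl)
open import Data.Product using (∃; ∃-syntax; _×_; _,_; proj₁; proj₂)
open import Data.Sum using (_⊎_; inj₁; inj₂)
open import Data.Unit using (tt) renaming (⊤ to Unit)
open import Function using (_∘_)
open import Function.Bundles using (module Equivalence; module Injection; module Inverse)
open import Function.Properties.Inverse using (↔⇒↣)
open import Level using (0ℓ) renaming (suc to lsuc)
open import Relation.Binary using (DecidableEquality)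
open import Relation.Binary.Construct.Closure.ReflexiveTransitive using (Star; ε; _◅_)
open import Relation.Binary.PropositionalEquality
  using (_≡_; _≢_; refl; sym; cong; subst)
open import Relation.Nullary using (Dec; yes; no; ¬_; ¬?)
open import Relation.Nullary.Decidable using (map′; _×-dec_; decidable-stable)
open import Relation.Unary using (_≐_; U; Pred; Decidable)
open TransitionSystem using (AllReachable; AtLeastTwoSuccessors; AtMostOneSuccessor)

-- The frame of truth values. Frame homomorphisms from `Lind M` into it are points, so by `sound` an
-- entailment fails once some model separates its two sides.
propositions : Frame (lsuc 0ℓ) 0ℓ 0ℓ
propositions = record
  { Carrier  = Set
  ; _≈_      = λ P Q → (P → Q) × (Q → P)
  ; _≤_      = λ P Q → P → Q
  ; _∧_      = _×_
  ; ⊤        = Unit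
  ; ⋁        = λ I P → ∃ P
  ; isBoundedMeetSemilattice = record
      { isMeetSemilattice = record
          { isPartialOrder = record
              { isPreorder = record
                  { isEquivalence = record
                      { refl  = (λ p → p) , (λ p → p)
                      ; sym   = λ (f , g) → g , f
                      ; trans = λ (f , g) (f′ , g′) → f′ ∘ f , g ∘ g′
                      }
                  ; reflexive = proj₁
                  ; trans     = λ f g → g ∘ f
                  }
              ; antisym = _,_
              }
          ; infimum = λ _ _ → proj₁ , proj₂ , λ _ f g r → f r , g r
          }
      ; maximum = λ _ _ → tt
      }
  ; ⋁-upper     = λ _ i p → i , p
  ; ⋁-least     = λ _ f (i , p) → f i p
  ; ∧-distrib-⋁ = λ _ _ (q , i , p) → i , q , p
  }

module _ (M : TransitionSystem) where
  open TransitionSystem M hiding (AllReachable; AtLeastTwoSuccessors; AtMostOneSuccessor)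
  open GraphAut

  private
    module L = Frame (Lind M)

    Branching : Pred State 0ℓ
    Branching = AtLeastTwoSuccessors M

    Deterministic : Pred State 0ℓ
    Deterministic s = AtMostOneSuccessor M s

  _≟ˢ_ : DecidableEquality State
  _≟ˢ_ = inj⇒≟ (↔⇒↣ finite)

  anyState? : ∀ {P : Pred State 0ℓ} → Decidable P → Dec (∃ P)
  anyState? {P} P? = map′
    (λ (i , p) → Inverse.from finite i , p)
    (λ (s , p) → Inverse.to finite s , subst P (sym (Inverse.strictlyInverseʳ finite s)) p)
    (any? λ i → P? (Inverse.from finite i))

  branching? : Decidable Branching
  branching? s = anyState? λ t → anyState? λ t′ →
    ¬? (t ≟ˢ t′) ×-dec (s ⟶? t) ×-dec (s ⟶? t′)

  ¬branching⇒deterministic : ∀ {s} → ¬ Branching s → Deterministic s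
  ¬branching⇒deterministic ¬b {t} {t′} p q =
    decidable-stable (t ≟ˢ t′) λ t≢t′ → ¬b (t , t′ , t≢t′ , p , q)

  otherSuccessor : ∀ {s} → Branching s → ∀ t → ∃[ u ] (u ≢ t × s ⟶ u)
  otherSuccessor (x , y , x≢y , p , q) t with x ≟ˢ t
  ... | yes refl = y , x≢y ∘ sym , q
  ... | no x≢t   = x , x≢t , p

  atom-⊢⇒≡ : ∀ {s t s′ t′} → s ⟶ t → Branching s′ →
             _⊢_ (𝕋 M) (atom (Δ s t)) (atom (Δ s′ t′)) → s ≡ s′ × t ≡ t′
  atom-⊢⇒≡ {s} {t} {s′} {t′} p b d =
    -- Equality of states is decidable, so the conclusion may be assumed false; this puts `s ⟶ t`
    -- into the model `v`, which omits `s′ ⟶ t′`.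
    decidable-stable ((s ≟ˢ s′) ×-dec (t ≟ˢ t′)) λ ≢ →
      proj₂ (sound propositions v v-axiom d (p , ≢)) (refl , refl)
    where
    v : TransitionAtom M → Set
    v (Δ x y) = x ⟶ y × ¬ (x ≡ s′ × y ≡ t′)

    v-axiom : ∀ {A B} → TransitionAxiom M A B →
              interpret {T = 𝕋 M} propositions v A → interpret {T = 𝕋 M} propositions v B
    v-axiom (no-transition ¬q) (q , _) = ⊥-elim (¬q q)
    v-axiom (progress {x} (y , q)) _ with x ≟ˢ s′
    ... | no x≢s′ = (y , q) , q , x≢s′ ∘ proj₁
    -- The only transition missing from `v` leaves `s′`, which has another successor by branching.
    ... | yes refl with u , u≢t′ , r ← otherSuccessor b t′ = (u , r) , r , u≢t′ ∘ proj₂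

  preserves-⟶ : ∀ (σ : GraphAut M) {s t} → s ⟶ t → to σ s ⟶ to σ t
  preserves-⟶ σ = Equivalence.to (preserves σ _ _)

  to-injective : ∀ (σ : GraphAut M) {s t} → to σ s ≡ to σ t → s ≡ t
  to-injective σ = Injection.injective (↔⇒↣ (perm σ))

  preserves-Branching : ∀ (σ : GraphAut M) {s} → Branching s → Branching (to σ s)
  preserves-Branching σ (t , t′ , t≢t′ , p , q) =
    to σ t , to σ t′ , t≢t′ ∘ to-injective σ , preserves-⟶ σ p , preserves-⟶ σ q

  reflects-Branching : ∀ (σ : GraphAut M) {s} → Branching (to σ s) → Branching s
  reflects-Branching σ {s} b = subst Branching (strictlyInverseʳ σ s)
    (preserves-Branching (_⁻¹ᵍ M σ) b)

  -- Requiring `¬ Branching s` in `later` makes that step forced, so a state has at most one index.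
  data BranchesAfter : ℕ → State → Set where
    now   : ∀ {s} → Branching s → BranchesAfter zero s
    later : ∀ {s t n} → ¬ Branching s → s ⟶ t → BranchesAfter n t → BranchesAfter (suc n) s

  preserves-BranchesAfter : ∀ (σ : GraphAut M) {n s} → BranchesAfter n s → BranchesAfter n (to σ s)
  preserves-BranchesAfter σ (now b)        = now (preserves-Branching σ b)
  preserves-BranchesAfter σ (later ¬b p d) =
    later (¬b ∘ reflects-Branching σ) (preserves-⟶ σ p) (preserves-BranchesAfter σ d)

  branchesAfter-unique : ∀ {m n s} → BranchesAfter m s → BranchesAfter n s → m ≡ n
  branchesAfter-unique (now _)        (now _)        = refl
  branchesAfter-unique (now b)        (later ¬b _ _) = ⊥-elim (¬b b)
  branchesAfter-unique (later ¬b _ _) (now b)        = ⊥-elim (¬b b)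
  branchesAfter-unique (later ¬b p d) (later _ q e)
    with refl ← ¬branching⇒deterministic ¬b p q = cong suc (branchesAfter-unique d e)

  branchesAfter : ∀ {s b} → Star _⟶_ s b → Branching b → ∃[ n ] BranchesAfter n s
  branchesAfter ε b = zero , now b
  branchesAfter {s} (p ◅ ps) b with branching? s
  ... | yes b′ = zero , now b′
  ... | no ¬b  with n , d ← branchesAfter ps b = suc n , later ¬b p d

  -- A path can only follow the forced segment, along which the count drops, until it leaves the
  -- branching state that ends it.
  reachable-cases : ∀ {s w n} → Star _⟶_ s w → BranchesAfter n s →
    s ≡ w ⊎ (∃[ m ] (m < n × BranchesAfter m w)) ⊎ (∃[ b ] (Branching b × Star _⟶_ b w))
  reachable-cases ε d = inj₁ refl
  reachable-cases (p ◅ ps) (now b) = inj₂ (inj₂ (_ , b , p ◅ ps))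
  reachable-cases (p ◅ ps) (later ¬b q d)
    with refl ← ¬branching⇒deterministic ¬b p q | reachable-cases ps d
  ... | inj₁ refl                   = inj₂ (inj₁ (_ , n<1+n _ , d))
  ... | inj₂ (inj₁ (m , m<n , e))   = inj₂ (inj₁ (m , m<n⇒m<1+n m<n , e))
  ... | inj₂ (inj₂ c)               = inj₂ (inj₂ c)

  module _ {σ : GraphAut M} (σ∈ker : ker (φ M) σ) where

    -- `φ` sends `Δ s t` to `Δ (to σ s) (to σ t)`, so one half of the kernel equation is an
    -- entailment to which `atom-⊢⇒≡` applies.
    ker-fixes-branching : ∀ {s t} → Branching s → s ⟶ t → to σ s ≡ s × to σ t ≡ t
    ker-fixes-branching b p = atom-⊢⇒≡ (preserves-⟶ σ p) b (proj₁ (σ∈ker (atom (Δ _ _))))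

    fixed-step : ∀ {s t} → to σ s ≡ s → s ⟶ t → to σ t ≡ t
    fixed-step {s} {t} fix p with branching? s
    ... | yes b = proj₂ (ker-fixes-branching b p)
    ... | no ¬b = ¬branching⇒deterministic ¬b (subst (_⟶ to σ t) fix (preserves-⟶ σ p)) p

    fixed-path : ∀ {s w} → to σ s ≡ s → Star _⟶_ s w → to σ w ≡ w
    fixed-path fix ε        = fix
    fixed-path fix (p ◅ ps) = fixed-path (fixed-step fix p) ps

    ker-fixes-init : AllReachable M → ∃ Branching → to σ init ≡ init
    ker-fixes-init reach (b , br)
      with n , d ← branchesAfter (reach b) br
      with reachable-cases (reach (to σ init)) d
    ... | inj₁ eq = sym eq
    -- `to σ init` would have count `m`, but `σ` carries over the count `n` of `init`.
    ... | inj₂ (inj₁ (m , m<n , e)) =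
      ⊥-elim (<-irrefl (branchesAfter-unique e (preserves-BranchesAfter σ d)) m<n)
    -- `σ` fixes `c`, hence also `to σ init`, which is reachable from `c`; injectivity then cancels
    -- one `σ`.
    ... | inj₂ (inj₂ (c , bc@(_ , _ , _ , p , _) , ps)) =
      to-injective σ (fixed-path (proj₁ (ker-fixes-branching bc p)) ps)

  ker-trivial : AllReachable M → ∃ Branching → ker (φ M) ≐ trivialSubgroup (AutGraph M)
  ker-trivial reach b =
      (λ {σ} k s → fixed-path {σ} k (ker-fixes-init {σ} k reach b) (reach s))
    , (λ {σ} σ≈ε A → L.≈.trans (⟦⟧-cong {σ} {εᵍ M} σ≈ε A) (ε-homo A))
    where open GroupHomomorphism (φ M) using (ε-homo; ⟦⟧-cong)

  -- With a single successor, every disjunct in `progress` is the same atom.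
  deterministic-atom-≈⊤ : ∀ {s t} → Deterministic s → s ⟶ t → atom (Δ s t) L.≈ ⊤ᶠ
  deterministic-atom-≈⊤ {s} det p = ⊤-intro ,
    ⊢-trans (axiom (progress (_ , p)))
      (⋁-elim λ (u , q) → L.≤-reflexive (L.≈.reflexive (cong (atom ∘ Δ s) (det q p))))

  ¬⟶⇒atom-≈⊥ : ∀ {s t} → ¬ s ⟶ t → atom (Δ s t) L.≈ ⊥ᶠ
  ¬⟶⇒atom-≈⊥ ¬p = axiom (no-transition ¬p) , ⋁-elim λ ()

  -- By `hom-unique` atoms suffice; `σ` preserves and reflects transitions, so an atom and its image
  -- are both ⊤ or both ⊥.
  ker-total : (∀ s → Deterministic s) → ker (φ M) ≐ U
  ker-total det = _ , λ {σ} _ → hom-unique (Lind M) (inducedHom M σ) (idHom (Lind M))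
    λ { (Δ s t) → fixes-atom σ s t }
    where
    fixes-atom : ∀ (σ : GraphAut M) s t → atom (Δ (to σ s) (to σ t)) L.≈ atom (Δ s t)
    fixes-atom σ s t with s ⟶? t
    ... | yes p = L.≈.trans (deterministic-atom-≈⊤ (det _) (preserves-⟶ σ p))
                            (L.≈.sym (deterministic-atom-≈⊤ (det s) p))
    ... | no ¬p = L.≈.trans (¬⟶⇒atom-≈⊥ (¬p ∘ Equivalence.from (preserves σ s t)))
                            (L.≈.sym (¬⟶⇒atom-≈⊥ ¬p))

  ker-dichotomy : AllReachable M →
    (ker (φ M) ≐ trivialSubgroup (AutGraph M)) ⊎ (ker (φ M) ≐ U)
  -- Finiteness makes this case split decidable, without excluded middle.
  ker-dichotomy reach with anyState? branching?
  ... | yes b = inj₁ (ker-trivial reach b)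
  ... | no ¬b = inj₂ (ker-total λ s → ¬branching⇒deterministic λ b → ¬b (s , b))

mainTheorem15 : (M : TransitionSystem) →
    AllReachable M →
    ((ker (φ M) ≐ trivialSubgroup (AutGraph M)) ⊎ (ker (φ M) ≐ U)) ×
    (∃ (AtLeastTwoSuccessors M) → ker (φ M) ≐ trivialSubgroup (AutGraph M)) ×
    ((∀ s → AtMostOneSuccessor M s) → ker (φ M) ≐ U)
mainTheorem15 M reach = ker-dichotomy M reach , ker-trivial M reach , ker-total M
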